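{- Let $A$ be a modal formula and let $t$ be a translation for $A$ based on a sequence $Q=\{q_i\}_{i=0}^\infty$ of atoms not occurring in $A$. If $\mathbf{GL}\vdash A^t$, then $\mathbf{K4}\vdash A$.
   Context: Modal formulas are built from atoms and $\bot$ using $\wedge,\vee,\to,\neg,\Box$. $\mathbf{K4}$ is the normal modal logic with axioms $\mathbf{K}$ and $\Box A\to\Box\Box A$; $\mathbf{GL}$ is $\mathbf{K4}$ plus Löb's axiom $\Box(\Box A\to A)\to\Box A$. A translation $t$ for $A$ based on $Q$ is an assignment of natural numbers to the occurrences of $\Box$ in $A$ such that the number assigned to any box occurrence is greater than the numbers assigned to all box occurrences within its scope. $A^t$ is defined by: $p^t=p$ for atoms; $(B\circ C)^t=B^t\circ C^t$ for $\circ\in\{\wedge,\vee,\to\}$; $(\neg B)^t=\neg B^t$; $(\Box B)^t=\Box(\bigwedge_{i=0}^n q_i\to B^t)$ where $n$ is the number $t$ assigns to that box occurrence.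
   Formalization: The atoms q_i of the sequence Q are required to be pairwise distinct; with repetitions the claim fails (all q_i equal to one atom q, A = □(□p→p)→□p, where GL proves A^t but K4 does not prove A). -}

module Defs where

open import Data.Bool.Base as Bool using (Bool; true; false; not)
open import Data.Nat.Base using (ℕ; zero; suc; _<_)
open import Function.Base using (_∘_)
open import Relation.Binary.PropositionalEquality using (_≡_)
open import Relation.Unary using (Pred)
open import Level using (0ℓ)

infixr 7 _∧_
infixr 6 _∨_
infixr 5 _⇒_
infix  8 ¬'_ □_
infix  3 _⊢_
infix  4 _OccursIn_ _InScopeOf_

Atom : Set
Atom = ℕ

data Connective : Set where
  and or imp : Connective

data Formula : Set where
  atom : Atom → Formula
  ⊥'   : Formula
  bin  : Connective → Formula → Formula → Formula
  ¬'_  : Formula → Formula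
  □_   : Formula → Formula

pattern _∧_ A B = bin and A B
pattern _∨_ A B = bin or A B
pattern _⇒_ A B = bin imp A B

data _OccursIn_ (p : Atom) : Formula → Set where
  atom  : p OccursIn atom p
  left  : ∀ {c A B} → p OccursIn A → p OccursIn bin c A B
  right : ∀ {c A B} → p OccursIn B → p OccursIn bin c A B
  neg   : ∀ {A} → p OccursIn A → p OccursIn ¬' A
  box   : ∀ {A} → p OccursIn A → p OccursIn □ A

⟦_⟧ : Connective → Bool → Bool → Bool
⟦ and ⟧ a b = a Bool.∧ b
⟦ or  ⟧ a b = a Bool.∨ b
⟦ imp ⟧ a b = not a Bool.∨ b

-- Boxed formulas are treated as propositional variables: β B is the truth
-- value given to □ B.
eval : (Atom → Bool) → (Formula → Bool) → Formula → Bool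
eval α β (atom p)    = α p
eval α β ⊥'          = false
eval α β (bin c A B) = ⟦ c ⟧ (eval α β A) (eval α β B)
eval α β (¬' A)      = not (eval α β A)
eval α β (□ A)       = β A

Tautology : Pred Formula 0ℓ
Tautology A = ∀ α β → eval α β A ≡ true

-- The least normal modal logic containing the axioms Ax. There is no
-- substitution rule, so Ax must be given by schemata.
data _⊢_ (Ax : Pred Formula 0ℓ) : Formula → Set where
  taut : ∀ {A} → Tautology A → Ax ⊢ A
  K    : ∀ {A B} → Ax ⊢ □ (A ⇒ B) ⇒ □ A ⇒ □ B
  ax   : ∀ {A} → Ax A → Ax ⊢ A
  mp   : ∀ {A B} → Ax ⊢ A ⇒ B → Ax ⊢ A → Ax ⊢ B
  nec  : ∀ {A} → Ax ⊢ A → Ax ⊢ □ A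

data K4 : Pred Formula 0ℓ where
  four : ∀ {A} → K4 (□ A ⇒ □ □ A)

data GL : Pred Formula 0ℓ where
  k4  : ∀ {A} → K4 A → GL A
  löb : ∀ {A} → GL (□ (□ A ⇒ A) ⇒ □ A)

data BoxOcc : Formula → Set where
  left  : ∀ {c A B} → BoxOcc A → BoxOcc (bin c A B)
  right : ∀ {c A B} → BoxOcc B → BoxOcc (bin c A B)
  neg   : ∀ {A} → BoxOcc A → BoxOcc (¬' A)
  here  : ∀ {A} → BoxOcc (□ A)
  under : ∀ {A} → BoxOcc A → BoxOcc (□ A)

-- A box occurrence is not in its own scope.
data _InScopeOf_ : ∀ {A} → BoxOcc A → BoxOcc A → Set where
  here  : ∀ {A} {o : BoxOcc A} → under o InScopeOf here
  left  : ∀ {c A B} {o o′ : BoxOcc A} → o InScopeOf o′ →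
          left {c} {A} {B} o InScopeOf left o′
  right : ∀ {c A B} {o o′ : BoxOcc B} → o InScopeOf o′ →
          right {c} {A} {B} o InScopeOf right o′
  neg   : ∀ {A} {o o′ : BoxOcc A} → o InScopeOf o′ → neg o InScopeOf neg o′
  under : ∀ {A} {o o′ : BoxOcc A} → o InScopeOf o′ → under o InScopeOf under o′

record Translation (A : Formula) : Set where
  field
    number     : BoxOcc A → ℕ
    increasing : ∀ {o o′} → o InScopeOf o′ → number o < number o′

-- ⋀ q n is q 0 ∧ … ∧ q n, both ends included.
⋀ : (ℕ → Atom) → ℕ → Formula
⋀ q zero    = atom (q zero)
⋀ q (suc n) = ⋀ q n ∧ atom (q (suc n))

translate : (ℕ → Atom) → (A : Formula) → (BoxOcc A → ℕ) → Formula
translate q (atom p)    t = atom p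
translate q ⊥'          t = ⊥'
translate q (bin c A B) t = bin c (translate q A (t ∘ left)) (translate q B (t ∘ right))
translate q (¬' A)      t = ¬' translate q A (t ∘ neg)
translate q (□ A)       t = □ (⋀ q (t here) ⇒ translate q A (t ∘ under))

{-# OPTIONS --safe #-}

-- Read a modal formula at a level i ∈ ℕ: □ B holds at i when □ (B at level j)
-- holds for every j < i. Descending levels make Löb's axiom provable in K4 by
-- induction on i, so every theorem of GL becomes a theorem of K4 at each
-- level. Let q k hold exactly at the levels j ≥ k. Then the guard q 0 ∧ … ∧ q n
-- of a box numbered n removes the levels below n, while level n remains, and
-- there all boxes in its scope, having smaller numbers, are still read
-- correctly. So the translation of A, read at a level above all its numbers,
-- is K4-equivalent to A.
module Submission where

open import Defs
open import Data.Bool.Base using (Bool; true; false; not)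
open import Data.Empty using (⊥-elim)
open import Data.Nat.Base using (ℕ; zero; suc; _+_; _≤_; _<_; s≤s)
open import Data.Nat.Properties using
  (_≟_; _≤?_; anyUpTo?; ≤-refl; <-trans; <-≤-trans; <⇒≤; <⇒≱; ≰⇒>; n<1+n; m≤m+n; m≤n+m;
   m≤n⇒m<n∨m≡n)
open import Data.Product.Base using (∃; _,_)
open import Data.Sum.Base using (inj₁; inj₂)
open import Function.Base using (_∘_)
open import Function.Definitions using (Injective)
open import Relation.Binary.PropositionalEquality using (_≡_; refl; sym; trans; cong; cong₂; subst)
open import Relation.Nullary using (¬_; Dec; yes; no)
open import Relation.Unary using (Pred)
open import Level using (0ℓ)

-- Propositional and normal modal reasoning over arbitrary axioms

⊤' : Formula
⊤' = ¬' ⊥'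

infix 4 _⇔_

_⇔_ : Formula → Formula → Formula
A ⇔ B = (A ⇒ B) ∧ (B ⇒ A)

module _ {Ax : Pred Formula 0ℓ} where

  weaken : ∀ {A B} → Ax ⊢ B → Ax ⊢ A ⇒ B
  weaken {A} {B} = mp (taut λ α β → lemma (eval α β A) (eval α β B))
    where
    lemma : ∀ a b → ⟦ imp ⟧ b (⟦ imp ⟧ a b) ≡ true
    lemma a     false = refl
    lemma false true  = refl
    lemma true  true  = refl

  ⇒-app : ∀ {A B C} → Ax ⊢ C ⇒ A ⇒ B → Ax ⊢ C ⇒ A → Ax ⊢ C ⇒ B
  ⇒-app {A} {B} {C} d e =
    mp (mp (taut λ α β → lemma (eval α β A) (eval α β B) (eval α β C)) d) e
    where
    lemma : ∀ a b c → ⟦ imp ⟧ (⟦ imp ⟧ c (⟦ imp ⟧ a b)) (⟦ imp ⟧ (⟦ imp ⟧ c a) (⟦ imp ⟧ c b)) ≡ true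
    lemma a     b     false = refl
    lemma false b     true  = refl
    lemma true  false true  = refl
    lemma true  true  true  = refl

  ∧-intro : ∀ {A B} → Ax ⊢ A ⇒ B ⇒ A ∧ B
  ∧-intro {A} {B} = taut λ α β → lemma (eval α β A) (eval α β B)
    where
    lemma : ∀ a b → ⟦ imp ⟧ a (⟦ imp ⟧ b (⟦ and ⟧ a b)) ≡ true
    lemma false b     = refl
    lemma true  false = refl
    lemma true  true  = refl

  ∧-elimˡ : ∀ {A B} → Ax ⊢ A ∧ B ⇒ A
  ∧-elimˡ {A} {B} = taut λ α β → lemma (eval α β A) (eval α β B)
    where
    lemma : ∀ a b → ⟦ imp ⟧ (⟦ and ⟧ a b) a ≡ true
    lemma false b     = refl
    lemma true  false = refl
    lemma true  true  = refl

  ∧-elimʳ : ∀ {A B} → Ax ⊢ A ∧ B ⇒ B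
  ∧-elimʳ {A} {B} = taut λ α β → lemma (eval α β A) (eval α β B)
    where
    lemma : ∀ a b → ⟦ imp ⟧ (⟦ and ⟧ a b) b ≡ true
    lemma false b     = refl
    lemma true  false = refl
    lemma true  true  = refl

  ⇒-curry : ∀ {A B C} → Ax ⊢ A ∧ B ⇒ C → Ax ⊢ A ⇒ B ⇒ C
  ⇒-curry {A} {B} {C} = mp (taut λ α β → lemma (eval α β A) (eval α β B) (eval α β C))
    where
    lemma : ∀ a b c → ⟦ imp ⟧ (⟦ imp ⟧ (⟦ and ⟧ a b) c) (⟦ imp ⟧ a (⟦ imp ⟧ b c)) ≡ true
    lemma false false c     = refl
    lemma false true  c     = refl
    lemma true  false c     = refl
    lemma true  true  false = refl
    lemma true  true  true  = refl

  ¬-elim : ∀ {A B} → Ax ⊢ ¬' A → Ax ⊢ A ⇒ B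
  ¬-elim {A} {B} = mp (taut λ α β → lemma (eval α β A) (eval α β B))
    where
    lemma : ∀ a b → ⟦ imp ⟧ (not a) (⟦ imp ⟧ a b) ≡ true
    lemma false b = refl
    lemma true  b = refl

  ¬-∧ʳ : ∀ {A B} → Ax ⊢ ¬' B → Ax ⊢ ¬' (A ∧ B)
  ¬-∧ʳ {A} {B} = mp (taut λ α β → lemma (eval α β A) (eval α β B))
    where
    lemma : ∀ a b → ⟦ imp ⟧ (not b) (not (⟦ and ⟧ a b)) ≡ true
    lemma a     true  = refl
    lemma false false = refl
    lemma true  false = refl

  ⊤-intro : Ax ⊢ ⊤'
  ⊤-intro = taut λ α β → refl

  ⇒-refl : ∀ {A} → Ax ⊢ A ⇒ A
  ⇒-refl {A} = taut λ α β → lemma (eval α β A)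
    where
    lemma : ∀ a → ⟦ imp ⟧ a a ≡ true
    lemma false = refl
    lemma true  = refl

  ⇒-trans : ∀ {A B C} → Ax ⊢ A ⇒ B → Ax ⊢ B ⇒ C → Ax ⊢ A ⇒ C
  ⇒-trans d e = ⇒-app (weaken e) d

  ⇒-pair : ∀ {A B C} → Ax ⊢ C ⇒ A → Ax ⊢ C ⇒ B → Ax ⊢ C ⇒ A ∧ B
  ⇒-pair d e = ⇒-app (⇒-trans d ∧-intro) e

  ⇔-intro : ∀ {A B} → Ax ⊢ A ⇒ B → Ax ⊢ B ⇒ A → Ax ⊢ A ⇔ B
  ⇔-intro d e = mp (mp ∧-intro d) e

  ⇔-to : ∀ {A B} → Ax ⊢ A ⇔ B → Ax ⊢ A ⇒ B
  ⇔-to = mp ∧-elimˡ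

  ⇔-from : ∀ {A B} → Ax ⊢ A ⇔ B → Ax ⊢ B ⇒ A
  ⇔-from = mp ∧-elimʳ

  ⇔-reflexive : ∀ {A B} → A ≡ B → Ax ⊢ A ⇔ B
  ⇔-reflexive refl = ⇔-intro ⇒-refl ⇒-refl

  bin-cong : ∀ c {A A′ B B′} → Ax ⊢ A ⇔ A′ → Ax ⊢ B ⇔ B′ → Ax ⊢ bin c A B ⇔ bin c A′ B′
  bin-cong c {A} {A′} {B} {B′} d e =
    mp (mp (taut λ α β → lemma (eval α β A) (eval α β A′) (eval α β B) (eval α β B′)) d) e
    where
    iff : Bool → Bool → Bool
    iff a b = ⟦ and ⟧ (⟦ imp ⟧ a b) (⟦ imp ⟧ b a)

    iff-refl : ∀ a → iff a a ≡ true
    iff-refl false = refl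
    iff-refl true  = refl

    lemma : ∀ a a′ b b′ →
      ⟦ imp ⟧ (iff a a′) (⟦ imp ⟧ (iff b b′) (iff (⟦ c ⟧ a b) (⟦ c ⟧ a′ b′))) ≡ true
    -- `c` is never split: where arguments disagree a premise is false, and where they agree both
    -- sides of the conclusion are the same value.
    lemma false true  b     b′    = refl
    lemma true  false b     b′    = refl
    lemma false false false true  = refl
    lemma false false true  false = refl
    lemma true  true  false true  = refl
    lemma true  true  true  false = refl
    lemma false false false false = iff-refl (⟦ c ⟧ false false)
    lemma false false true  true  = iff-refl (⟦ c ⟧ false true)
    lemma true  true  false false = iff-refl (⟦ c ⟧ true false)
    lemma true  true  true  true  = iff-refl (⟦ c ⟧ true true)

  ¬-cong : ∀ {A A′} → Ax ⊢ A ⇔ A′ → Ax ⊢ ¬' A ⇔ ¬' A′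
  ¬-cong {A} {A′} = mp (taut λ α β → lemma (eval α β A) (eval α β A′))
    where
    lemma : ∀ a a′ → ⟦ imp ⟧ (⟦ and ⟧ (⟦ imp ⟧ a a′) (⟦ imp ⟧ a′ a))
                             (⟦ and ⟧ (⟦ imp ⟧ (not a) (not a′)) (⟦ imp ⟧ (not a′) (not a))) ≡ true
    lemma false false = refl
    lemma false true  = refl
    lemma true  false = refl
    lemma true  true  = refl

  □-app : ∀ {A B C} → Ax ⊢ C ⇒ □ (A ⇒ B) → Ax ⊢ C ⇒ □ A → Ax ⊢ C ⇒ □ B
  □-app d e = ⇒-app (⇒-trans d K) e

  □-mono : ∀ {A B} → Ax ⊢ A ⇒ B → Ax ⊢ □ A ⇒ □ B
  □-mono d = mp K (nec d)

  □-pair : ∀ {A B C} → Ax ⊢ C ⇒ □ A → Ax ⊢ C ⇒ □ B → Ax ⊢ C ⇒ □ (A ∧ B)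
  □-pair d e = □-app (⇒-trans d (□-mono ∧-intro)) e

-- Formulas read at a level

boxes : (ℕ → Formula) → ℕ → Formula
boxes f zero    = ⊤'
boxes f (suc i) = boxes f i ∧ □ f i

-- Since `σ` depends on the level, this is not a uniform substitution: under a box the same atom may
-- be read differently at each lower level.
atLevel : (ℕ → Atom → Formula) → ℕ → Formula → Formula
atLevel σ i (atom p)    = σ i p
atLevel σ i ⊥'          = ⊥'
atLevel σ i (bin c A B) = bin c (atLevel σ i A) (atLevel σ i B)
atLevel σ i (¬' A)      = ¬' atLevel σ i A
atLevel σ i (□ A)       = boxes (λ j → atLevel σ j A) i

module _ {Ax : Pred Formula 0ℓ} where

  boxes-intro : ∀ {f C} i → (∀ j → j < i → Ax ⊢ C ⇒ □ f j) → Ax ⊢ C ⇒ boxes f i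
  boxes-intro zero    d = weaken ⊤-intro
  boxes-intro (suc i) d =
    ⇒-pair (boxes-intro i λ j j<i → d j (<-trans j<i (n<1+n i))) (d i (n<1+n i))

  boxes-elim : ∀ {f i j} → j < i → Ax ⊢ boxes f i ⇒ □ f j
  boxes-elim {i = suc i} (s≤s j≤i) with m≤n⇒m<n∨m≡n j≤i
  ... | inj₁ j<i  = ⇒-trans ∧-elimˡ (boxes-elim j<i)
  ... | inj₂ refl = ∧-elimʳ

-- Axiom `four` boxes each conjunct, and boxes distribute over finite conjunctions.
boxes-4 : ∀ {f} i → K4 ⊢ boxes f i ⇒ □ boxes f i
boxes-4 zero    = weaken (nec ⊤-intro)
boxes-4 (suc i) = □-pair (⇒-trans ∧-elimˡ (boxes-4 i)) (⇒-trans ∧-elimʳ (ax four))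

-- The hypothesis at level `j` asks only for boxes below `j`, so there is no circularity:
-- `boxes f i`, obtained by induction, is boxed by `boxes-4` and detaches the antecedent inside
-- `□ (boxes f i ⇒ f i)`.
boxes-löb : ∀ {f} i → K4 ⊢ boxes (λ j → boxes f j ⇒ f j) i ⇒ boxes f i
boxes-löb {f} zero    = weaken ⊤-intro
boxes-löb {f} (suc i) = ⇒-pair IH (□-app ∧-elimʳ (⇒-trans IH (boxes-4 i)))
  where
  IH : K4 ⊢ boxes (λ j → boxes f j ⇒ f j) (suc i) ⇒ boxes f i
  IH = ⇒-trans ∧-elimˡ (boxes-löb i)

-- From GL to K4 at every level

module _ (σ : ℕ → Atom → Formula) where

  -- At a fixed level only atoms and boxed formulas are reinterpreted, so tautologies stay
  -- tautologies.
  eval-atLevel : ∀ α β i A →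
    eval α β (atLevel σ i A) ≡ eval (eval α β ∘ σ i) (λ B → eval α β (atLevel σ i (□ B))) A
  eval-atLevel α β i (atom p)    = refl
  eval-atLevel α β i ⊥'          = refl
  eval-atLevel α β i (bin c A B) = cong₂ ⟦ c ⟧ (eval-atLevel α β i A) (eval-atLevel α β i B)
  eval-atLevel α β i (¬' A)      = cong not (eval-atLevel α β i A)
  eval-atLevel α β i (□ A)       = refl

  GL⇒K4-atLevel : ∀ {A} → GL ⊢ A → ∀ i → K4 ⊢ atLevel σ i A
  GL⇒K4-atLevel {A} (taut A-taut) i =
    taut λ α β → trans (eval-atLevel α β i A) (A-taut _ _)
  GL⇒K4-atLevel K i = ⇒-curry (boxes-intro i λ j j<i →
    □-app (⇒-trans ∧-elimˡ (boxes-elim j<i)) (⇒-trans ∧-elimʳ (boxes-elim j<i)))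
  -- The boxes below `i` include those below `j`, and `boxes-4` prefixes a box to the latter.
  GL⇒K4-atLevel (ax (k4 four)) i = boxes-intro i λ j j<i →
    ⇒-trans (boxes-intro j λ k k<j → boxes-elim (<-trans k<j j<i)) (boxes-4 j)
  GL⇒K4-atLevel (ax löb) i = boxes-löb i
  GL⇒K4-atLevel (mp d e) i = mp (GL⇒K4-atLevel d i) (GL⇒K4-atLevel e i)
  -- The premise is used at every lower level, which is why the induction keeps the level arbitrary.
  GL⇒K4-atLevel (nec d)  i =
    mp (boxes-intro i λ j _ → weaken (nec (GL⇒K4-atLevel d j))) ⊤-intro

-- The translation read at a level

module _ {q : ℕ → Atom} {σ : ℕ → Atom → Formula} {N : ℕ}
         (σ-≥ : ∀ {i k} → k < N → k ≤ i → σ i (q k) ≡ ⊤')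
         (σ-< : ∀ {i k} → k < N → i < k → σ i (q k) ≡ ⊥') where

  ⋀-true : ∀ {i} n → n < N → n ≤ i → K4 ⊢ atLevel σ i (⋀ q n)
  ⋀-true zero    n<N n≤i = subst (K4 ⊢_) (sym (σ-≥ n<N n≤i)) ⊤-intro
  ⋀-true (suc n) n<N n≤i =
    mp (mp ∧-intro (⋀-true n (<⇒≤ n<N) (<⇒≤ n≤i))) (subst (K4 ⊢_) (sym (σ-≥ n<N n≤i)) ⊤-intro)

  -- The last conjunct alone fails. No level lies below 0, so `zero` needs no clause.
  ⋀-false : ∀ {i} n → n < N → i < n → K4 ⊢ ¬' atLevel σ i (⋀ q n)
  ⋀-false (suc n) n<N i<n = ¬-∧ʳ (subst (λ B → K4 ⊢ ¬' B) (sym (σ-< n<N i<n)) ⊤-intro)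

  -- The condition `number o < i` ensures that an outermost box, read at `i`, still reaches the
  -- level equal to its number; `i ≤ N` keeps the guard atoms where `σ-≥` and `σ-<` apply.
  translate-atLevel : ∀ A (t : Translation A) → let open Translation t in
    (∀ {i p} → p OccursIn A → σ i p ≡ atom p) →
    ∀ i → i ≤ N → (∀ o → number o < i) → K4 ⊢ atLevel σ i (translate q A number) ⇔ A
  translate-atLevel (atom p) t fixed i i≤N t<i = ⇔-reflexive (fixed atom)
  translate-atLevel ⊥' t fixed i i≤N t<i = ⇔-reflexive refl
  translate-atLevel (bin c A B) t fixed i i≤N t<i = bin-cong c
    (translate-atLevel A (record { increasing = increasing ∘ left }) (fixed ∘ left) i i≤N (t<i ∘ left))
    (translate-atLevel B (record { increasing = increasing ∘ right }) (fixed ∘ right) i i≤N (t<i ∘ right))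
    where open Translation t
  translate-atLevel (¬' A) t fixed i i≤N t<i = ¬-cong
    (translate-atLevel A (record { increasing = increasing ∘ neg }) (fixed ∘ neg) i i≤N (t<i ∘ neg))
    where open Translation t
  translate-atLevel (□ A) t fixed i i≤N t<i = ⇔-intro
    -- The conjunct for level `n` suffices: its guard is provable there and can be discharged.
    (⇒-trans (boxes-elim n<i)
             (□-mono (⇒-trans (⇒-app ⇒-refl (weaken (⋀-true n n<N ≤-refl))) (⇔-to (IH n ≤-refl n<N)))))
    -- Every level below `i` must be served: under `n` the guard is refutable, from `n` on the
    -- induction hypothesis applies.
    (boxes-intro i λ j j<i → □-mono (guarded j j<i (n ≤? j)))
    where
    open Translation t

    n : ℕ
    n = number here

    n<i : n < i
    n<i = t<i here

    n<N : n < N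
    n<N = <-≤-trans n<i i≤N

    IH : ∀ j → n ≤ j → j < N → K4 ⊢ atLevel σ j (translate q A (number ∘ under)) ⇔ A
    IH j n≤j j<N = translate-atLevel A (record { increasing = increasing ∘ under }) (fixed ∘ box)
      -- Boxes in the scope have numbers below `n`, hence below `j`.
      j (<⇒≤ j<N) (λ o → <-≤-trans (increasing here) n≤j)

    guarded : ∀ j → j < i → Dec (n ≤ j) →
      K4 ⊢ A ⇒ atLevel σ j (⋀ q n) ⇒ atLevel σ j (translate q A (number ∘ under))
    guarded j j<i (yes n≤j) = ⇒-curry (⇒-trans ∧-elimˡ (⇔-from (IH j n≤j (<-≤-trans j<i i≤N))))
    guarded j j<i (no n≰j)  = weaken (¬-elim (⋀-false n n<N (≰⇒> n≰j)))

-- The level-dependent substitution for the guard atoms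

-- Membership in the range of q is undecidable, hence the bound N.
module _ (q : ℕ → Atom) (N : ℕ) where

  guardAt : ℕ → ℕ → Formula
  guardAt i k with k ≤? i
  ... | yes _ = ⊤'
  ... | no  _ = ⊥'

  levelSubst : ℕ → Atom → Formula
  levelSubst i p with anyUpTo? (λ k → q k ≟ p) N
  ... | yes (k , _) = guardAt i k
  ... | no  _       = atom p

  levelSubst-fixed : ∀ {p} → (∀ k → ¬ (q k ≡ p)) → ∀ {i} → levelSubst i p ≡ atom p
  levelSubst-fixed {p} p∉q with anyUpTo? (λ k → q k ≟ p) N
  ... | yes (k , _ , qk≡p) = ⊥-elim (p∉q k qk≡p)
  ... | no  _              = refl

  module _ (q-inj : Injective _≡_ _≡_ q) where

    -- The search may return any index with the same atom; injectivity identifies it with `k`.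
    levelSubst-guard : ∀ {i k} → k < N → levelSubst i (q k) ≡ guardAt i k
    levelSubst-guard {i} {k} k<N with anyUpTo? (λ l → q l ≟ q k) N
    ... | yes (l , _ , ql≡qk) = cong (guardAt i) (q-inj ql≡qk)
    ... | no  none            = ⊥-elim (none (k , k<N , refl))

    levelSubst-≥ : ∀ {i k} → k < N → k ≤ i → levelSubst i (q k) ≡ ⊤'
    levelSubst-≥ {i} {k} k<N k≤i = trans (levelSubst-guard k<N) guard-true
      where
      guard-true : guardAt i k ≡ ⊤'
      guard-true with k ≤? i
      ... | yes _   = refl
      ... | no  k≰i = ⊥-elim (k≰i k≤i)

    levelSubst-< : ∀ {i k} → k < N → i < k → levelSubst i (q k) ≡ ⊥'
    levelSubst-< {i} {k} k<N i<k = trans (levelSubst-guard k<N) guard-false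
      where
      guard-false : guardAt i k ≡ ⊥'
      guard-false with k ≤? i
      ... | yes k≤i = ⊥-elim (<⇒≱ i<k k≤i)
      ... | no  _   = refl

-- Bounding the box numbers, and the conclusion

BoxOcc-bounded : ∀ A (t : BoxOcc A → ℕ) → ∃ λ N → ∀ o → t o < N
BoxOcc-bounded (atom p) t = 0 , λ ()
BoxOcc-bounded ⊥' t = 0 , λ ()
BoxOcc-bounded (bin c A B) t with BoxOcc-bounded A (t ∘ left) | BoxOcc-bounded B (t ∘ right)
... | M , t<M | N , t<N = M + N , λ where
  (left o)  → <-≤-trans (t<M o) (m≤m+n M N)
  (right o) → <-≤-trans (t<N o) (m≤n+m N M)
BoxOcc-bounded (¬' A) t with BoxOcc-bounded A (t ∘ neg)
... | N , t<N = N , λ where (neg o) → t<N o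
BoxOcc-bounded (□ A) t with BoxOcc-bounded A (t ∘ under)
... | N , t<N = suc (t here) + N , λ where
  here      → m≤m+n (suc (t here)) N
  (under o) → <-≤-trans (t<N o) (m≤n+m N (suc (t here)))

theorem4p3 : (A : Formula) (q : ℕ → Atom) → Injective _≡_ _≡_ q → (∀ i → ¬ (q i OccursIn A)) →
    (t : Translation A) → GL ⊢ translate q A (Translation.number t) → K4 ⊢ A
theorem4p3 A q q-inj q∉A t d with BoxOcc-bounded A (Translation.number t)
-- `N` is both the bound on the substituted indices and the level of reading: it exceeds every box
-- number.
... | N , t<N = mp (⇔-to A^t⇔A) (GL⇒K4-atLevel (levelSubst q N) d N)
  where
  A^t⇔A : K4 ⊢ atLevel (levelSubst q N) N (translate q A (Translation.number t)) ⇔ A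
  A^t⇔A = translate-atLevel (levelSubst-≥ q N q-inj) (levelSubst-< q N q-inj) A t
    (λ p∈A → levelSubst-fixed q N λ k qk≡p → q∉A k (subst (_OccursIn A) (sym qk≡p) p∈A))
    N ≤-refl t<N
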